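{- Let $r\ge 20$ and $n\ge 1$ be integers, let $G=K_r^n$, and let $0\le\epsilon<10^{ -9}$. Suppose $J$ is an independent set of $G$ with $\frac{|J|}{|G|}=\frac{1}{r}(1-\epsilon)$. Then there exists an independent set $I$ of $G$ with $\frac{|I|}{|G|}=\frac{1}{r}$ such that $\frac{|J\triangle I|}{|G|}<\frac{40\epsilon}{r}$.
   Context: $K_r^n$ is the $n$-fold weak (tensor) product of the complete graph $K_r$: its vertex set is $\mathbb{Z}_r^n$, and two vertices $x,y\in\mathbb{Z}_r^n$ are adjacent iff $x_j\neq y_j$ for every coordinate $j=1,\dots,n$. $|G|=r^n$ denotes the number of vertices, and $\triangle$ denotes symmetric difference. (For $r>2$ the independent sets of size $r^{n-1}$ are exactly the sets $\{x: x_j=i\}$ for fixed $j,i$.)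
   Formalization: At ε = 0 the strict inequality is impossible (take J = {x : x_1 = 0}), so the formal conclusion is |J△I|/|G| ≤ 40ε/r for all 0 ≤ ε < 10^{ -9}, with the strict inequality whenever ε > 0. -}

module Defs where

open import Data.Bool.Base using (Bool; T; _xor_)
open import Data.Fin.Base using (Fin)
open import Data.Integer.Base using (+_)
open import Data.List.Base using (List; []; _∷_; length; allFin; filterᵇ; cartesianProductWith)
open import Data.List.Membership.Propositional using (_∈_)
open import Data.List.Membership.Propositional.Properties using (∈-allFin; ∈-cartesianProductWith⁺)
open import Data.List.Relation.Unary.Any using (here)
import Data.List.Relation.Unary.All as All
import Data.List.Relation.Unary.AllPairs as AllPairs
open import Data.List.Relation.Unary.Unique.Propositional using (Unique)
open import Data.List.Relation.Unary.Unique.Propositional.Properties using (allFin⁺; cartesianProductWith⁺)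
open import Data.Nat.Base using (ℕ; zero; suc; NonZero; _^_)
open import Data.Nat.Properties using (m^n≢0)
open import Data.Rational.Base using (ℚ; _/_)
import Data.Vec.Base as Vec
open import Data.Vec.Base using (Vec; lookup)
open import Data.Vec.Properties using (∷-injective)
open import Relation.Binary.PropositionalEquality using (_≡_; _≢_; refl)
open import Relation.Nullary.Negation using (¬_)

-- Only the underlying set of ℤ_r matters for K_r^n, so it is taken to be Fin r.
Vertex : ℕ → ℕ → Set
Vertex r n = Vec (Fin r) n

Adjacent : ∀ {r n} → Vertex r n → Vertex r n → Set
Adjacent x y = ∀ j → lookup x j ≢ lookup y j

-- Bool-valued characteristic functions, so that every set of vertices has a
-- cardinality.
VertexSet : ℕ → ℕ → Set
VertexSet r n = Vertex r n → Bool

Independent : ∀ {r n} → VertexSet r n → Set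
Independent S = ∀ x y → T (S x) → T (S y) → ¬ Adjacent x y

infixl 6 _△_

_△_ : ∀ {r n} → VertexSet r n → VertexSet r n → VertexSet r n
(S △ S′) x = S x xor S′ x

vertices : ∀ r n → List (Vertex r n)
vertices r zero    = Vec.[] ∷ []
vertices r (suc n) = cartesianProductWith Vec._∷_ (allFin r) (vertices r n)

vertices-complete : ∀ {r n} (x : Vertex r n) → x ∈ vertices r n
vertices-complete Vec.[]       = here refl
vertices-complete (i Vec.∷ x) =
  ∈-cartesianProductWith⁺ Vec._∷_ (∈-allFin i) (vertices-complete x)

vertices-unique : ∀ r n → Unique (vertices r n)
vertices-unique r zero    = All.[] AllPairs.∷ AllPairs.[]
vertices-unique r (suc n) =
  cartesianProductWith⁺ Vec._∷_ ∷-injective (allFin⁺ r) (vertices-unique r n)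

card : ∀ {r n} → VertexSet r n → ℕ
card {r} {n} S = length (filterᵇ S (vertices r n))

-- |S| / |G| for G = K_r^n, where |G| = r ^ n.
density : ∀ {r n} .{{_ : NonZero r}} → VertexSet r n → ℚ
density {r} {n} S = (+ card S / r ^ n) {{m^n≢0 r n}}

{-# OPTIONS --safe #-}
module Submission where

-- Let p = 1/r, l = 1/(r − 1), and let T be the normalised adjacency operator, whose
-- eigenvalue on functions of degree k is (−l)^k.  For f the indicator of J we have
-- ⟨f, Tf⟩ = 0, so nearly all the variance of f sits in its degree-one part
-- h(x) = Σ_j g_j(x_j), where g_j(i) is the density of J on {x_j = i} minus its mean.
--
-- If all these conditional densities are at most 1/2, then h is a sum of independent
-- centred variables bounded by 1/2, so its fourth moment is at most 3 W² + W/4 with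
-- W = ‖h‖².  Integrating f h ≤ (3 f + h⁴)/4 gives W ≤ (7/8) E f, contradicting the
-- concentration on degree one.
--
-- So J fills a fraction a ≥ 1/2 of some {x_j = i}.  Every other slice {x_j = k} of J is
-- cross-independent from that one, and the spectral gap bounds its density by
-- 2 l² (1 − a).  Summing over k gives (1 − a)(1 − 2l) ≤ ε, so {x_j = i} is close to J.

open import Defs
import Algebra.Properties.CommutativeMonoid.Sum as CommutativeMonoidSum
import Algebra.Properties.Semiring.Sum as SemiringSum
open import Algebra.Bundles using (CommutativeRing)
open import Data.Bool.Base using (Bool; true; false; T; _xor_; if_then_else_)
open import Data.Fin.Base using (Fin; zero; suc)
import Data.Fin.Properties as Fin
open import Data.Integer.Base as ℤ using (+_)
import Data.Integer.Properties as ℤ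
open import Data.List.Base using (List; []; _∷_; length; map; _++_; filterᵇ; tabulate; cartesianProductWith)
open import Data.Maybe.Base using (Maybe; just; nothing)
open import Data.Nat.Base as ℕ using (ℕ; NonZero; zero; suc)
import Data.Nat.Properties as ℕ
open import Data.Product.Base using (∃-syntax; _×_; _,_; proj₁; proj₂)
open import Data.Rational.Base using (ℚ; 0ℚ; 1ℚ; ½; _/_; _+_; _*_; _-_; -_; _≤_; _<_; nonNegative; positive; fromℚᵘ)
open import Data.Rational.Properties
open import Data.Rational.Unnormalised.Base as ℚᵘ using (mkℚᵘ)
import Data.Rational.Unnormalised.Properties as ℚᵘ
open import Data.Sum.Base using (inj₁; inj₂)
open import Data.Unit.Base using (⊤; tt)
open import Data.Vec.Base using ([]; _∷_; insertAt; lookup)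
open import Data.Vec.Properties using (insertAt-lookup)
open import Level using (0ℓ)
open import Relation.Binary.PropositionalEquality using (_≡_; _≢_; refl; sym; trans; cong; cong₂; subst; subst₂; module ≡-Reasoning)
open import Relation.Nullary.Decidable using (⌊_⌋; toWitness)
open import Relation.Nullary using (¬_; yes; no; contradiction)
open import Tactic.RingSolver using (solve-∀)
import Tactic.RingSolver.Core.AlmostCommutativeRing as ACR

open CommutativeMonoidSum +-0-commutativeMonoid using (sum; sum-cong-≗; ∑-distrib-+)
open SemiringSum (CommutativeRing.semiring +-*-commutativeRing) using (*-distribˡ-sum; *-distribʳ-sum)

-- The zero test lets the solver discard coefficients that cancel, which identities with rational
-- constants depend on.
ℚ-ring : ACR.AlmostCommutativeRing 0ℓ 0ℓ
ℚ-ring = ACR.fromCommutativeRing +-*-commutativeRing is-zero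
  where
  is-zero : (q : ℚ) → Maybe (0ℚ ≡ q)
  is-zero q with 0ℚ ≟ q
  ... | yes 0≡q = just 0≡q
  ... | no  _   = nothing

private
  variable
    X Y : Set
    m n : ℕ
    α β γ : ℚ

-- Ordered-field arithmetic

≤⇒0≤- : α ≤ β → 0ℚ ≤ β - α
≤⇒0≤- {α} {β} α≤β = subst (_≤ β - α) (+-inverseʳ α) (+-monoˡ-≤ (- α) α≤β)

-- Inequalities are certified by writing the difference of the two sides as an
-- expression that is visibly nonnegative.
certify : β - α ≡ γ → 0ℚ ≤ γ → α ≤ β
certify {β} {α} β-α≡γ 0≤γ = subst₂ _≤_ (+-identityˡ α) (cancel β α)
  (+-monoˡ-≤ α (subst (0ℚ ≤_) (sym β-α≡γ) 0≤γ))
  where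
  cancel : ∀ b a → b - a + a ≡ b
  cancel = solve-∀ ℚ-ring

0≤+ : 0ℚ ≤ α → 0ℚ ≤ β → 0ℚ ≤ α + β
0≤+ = +-mono-≤

0≤* : 0ℚ ≤ α → 0ℚ ≤ β → 0ℚ ≤ α * β
0≤* {a} {b} 0≤a 0≤b = nonNegative⁻¹ (a * b)
  {{nonNeg*nonNeg⇒nonNeg a {{nonNegative 0≤a}} b {{nonNegative 0≤b}}}}

neg² : ∀ a → (- a) * (- a) ≡ a * a
neg² = solve-∀ ℚ-ring

0≤² : ∀ a → 0ℚ ≤ a * a
0≤² a with ≤-total 0ℚ a
... | inj₁ 0≤a = 0≤* 0≤a 0≤a
... | inj₂ a≤0 = subst (0ℚ ≤_) (neg² a) (0≤* 0≤-a 0≤-a)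
  where
  0≤-a : 0ℚ ≤ - a
  0≤-a = neg-antimono-≤ a≤0

0<* : 0ℚ < α → 0ℚ < β → 0ℚ < α * β
0<* {a} {b} 0<a 0<b = positive⁻¹ (a * b) {{pos*pos⇒pos a {{positive 0<a}} b {{positive 0<b}}}}

0≤-cancel-* : ∀ c a → 0ℚ < c → 0ℚ ≤ c * a → 0ℚ ≤ a
0≤-cancel-* c a 0<c 0≤ca = *-cancelˡ-≤-pos c {{positive 0<c}} (subst (_≤ c * a) (sym (*-zeroʳ c)) 0≤ca)

-- Linear functionals on functions

-- `congᴸ` is a field because pointwise equal functions are not propositionally equal without
-- extensionality.
record IsLinear (L : (X → ℚ) → ℚ) : Set where
  field
    congᴸ : ∀ {f g} → (∀ x → f x ≡ g x) → L f ≡ L g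
    +ᴸ    : ∀ f g → L (λ x → f x + g x) ≡ L f + L g
    *ᴸ    : ∀ c f → L (λ x → c * f x) ≡ c * L f

  -ᴸ : ∀ f g → L (λ x → f x - g x) ≡ L f - L g
  -ᴸ f g = begin
    L (λ x → f x - g x)            ≡⟨ congᴸ (λ x → eq (f x) (g x)) ⟩
    L (λ x → f x + (- 1ℚ) * g x)   ≡⟨ +ᴸ f _ ⟩
    L f + L (λ x → (- 1ℚ) * g x)   ≡⟨ cong (λ z → L f + z) (*ᴸ (- 1ℚ) g) ⟩
    L f + (- 1ℚ) * L g             ≡⟨ eq (L f) (L g) ⟨
    L f - L g                      ∎
    where
    open ≡-Reasoning
    eq : ∀ a b → a - b ≡ a + (- 1ℚ) * b
    eq = solve-∀ ℚ-ring

  0ᴸ : L (λ _ → 0ℚ) ≡ 0ℚ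
  0ᴸ = trans (*ᴸ 0ℚ (λ _ → 0ℚ)) (*-zeroˡ (L λ _ → 0ℚ))

  sumᴸ : (F : Fin m → X → ℚ) → L (λ x → sum λ i → F i x) ≡ sum λ i → L (F i)
  sumᴸ {zero}  F = 0ᴸ
  sumᴸ {suc m} F = trans (+ᴸ (F zero) (λ x → sum λ i → F (suc i) x))
    (cong (λ z → L (F zero) + z) (sumᴸ λ i → F (suc i)))

  axpyᴸ : ∀ f c g → L (λ x → f x + c * g x) ≡ L f + c * L g
  axpyᴸ f c g = trans (+ᴸ f (λ x → c * g x)) (cong (λ z → L f + z) (*ᴸ c g))

  doubleᴸ : ∀ c f → L (λ x → c * (f x + f x)) ≡ c * (L f + L f)
  doubleᴸ c f = trans (*ᴸ c _) (cong (c *_) (+ᴸ f f))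

open IsLinear

eval-linear : (x : X) → IsLinear (λ f → f x)
eval-linear x = record { congᴸ = λ e → e x ; +ᴸ = λ _ _ → refl ; *ᴸ = λ _ _ → refl }

scale-linear : ∀ {L : (X → ℚ) → ℚ} c → IsLinear L → IsLinear (λ f → c * L f)
scale-linear {L = L} c lin = record
  { congᴸ = λ e → cong (c *_) (congᴸ lin e)
  ; +ᴸ    = λ f g → trans (cong (c *_) (+ᴸ lin f g)) (*-distribˡ-+ c (L f) (L g))
  ; *ᴸ    = λ k f → trans (cong (c *_) (*ᴸ lin k f)) (swap c k (L f))
  }
  where
  swap : ∀ a b c → a * (b * c) ≡ b * (a * c)
  swap = solve-∀ ℚ-ring

scaleʳ-linear : ∀ {L : (X → ℚ) → ℚ} c → IsLinear L → IsLinear (λ f → L f * c)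
scaleʳ-linear {L = L} c lin = record
  { congᴸ = λ e → cong (_* c) (congᴸ lin e)
  ; +ᴸ    = λ f g → trans (cong (_* c) (+ᴸ lin f g)) (*-distribʳ-+ c (L f) (L g))
  ; *ᴸ    = λ k f → trans (cong (_* c) (*ᴸ lin k f)) (*-assoc k (L f) c)
  }

sub-linear : ∀ {L L′ : (X → ℚ) → ℚ} → IsLinear L → IsLinear L′ → IsLinear (λ f → L f - L′ f)
sub-linear {L = L} {L′} lin lin′ = record
  { congᴸ = λ e → cong₂ _-_ (congᴸ lin e) (congᴸ lin′ e)
  ; +ᴸ    = λ f g → trans (cong₂ _-_ (+ᴸ lin f g) (+ᴸ lin′ f g)) (exchange (L f) (L g) (L′ f) (L′ g))
  ; *ᴸ    = λ k f → trans (cong₂ _-_ (*ᴸ lin k f) (*ᴸ lin′ k f)) (factor k (L f) (L′ f))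
  }
  where
  exchange : ∀ a b c d → a + b - (c + d) ≡ a - c + (b - d)
  exchange = solve-∀ ℚ-ring
  factor : ∀ k a b → k * a - k * b ≡ k * (a - b)
  factor = solve-∀ ℚ-ring

∘-linear : ∀ {L : (X → ℚ) → ℚ} {A : (Y → ℚ) → X → ℚ} →
  IsLinear L → (∀ x → IsLinear (λ f → A f x)) → IsLinear (λ f → L (A f))
∘-linear linL linA = record
  { congᴸ = λ e → congᴸ linL (λ x → congᴸ (linA x) e)
  ; +ᴸ    = λ f g → trans (congᴸ linL (λ x → +ᴸ (linA x) f g)) (+ᴸ linL _ _)
  ; *ᴸ    = λ k f → trans (congᴸ linL (λ x → *ᴸ (linA x) k f)) (*ᴸ linL k _)
  }

sum-linear : IsLinear (sum {m})
sum-linear = record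
  { congᴸ = sum-cong-≗
  ; +ᴸ    = ∑-distrib-+
  ; *ᴸ    = λ c f → sym (*-distribˡ-sum c f)
  }

sum-mono-≤ : {u v : Fin m → ℚ} → (∀ i → u i ≤ v i) → sum u ≤ sum v
sum-mono-≤ {zero}  u≤v = ≤-refl
sum-mono-≤ {suc m} u≤v = +-mono-≤ (u≤v zero) (sum-mono-≤ (λ i → u≤v (suc i)))

-- Integer casts, finite sums and counting of vertices.

fromℚᵘ-homo-+ : ∀ x y → fromℚᵘ (x ℚᵘ.+ y) ≡ fromℚᵘ x + fromℚᵘ y
fromℚᵘ-homo-+ x y = toℚᵘ-injective (ℚᵘ.≃-trans (toℚᵘ-fromℚᵘ (x ℚᵘ.+ y))
  (ℚᵘ.≃-sym (ℚᵘ.≃-trans (toℚᵘ-homo-+ (fromℚᵘ x) (fromℚᵘ y))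
    (ℚᵘ.+-cong (toℚᵘ-fromℚᵘ x) (toℚᵘ-fromℚᵘ y)))))

fromℚᵘ-homo-* : ∀ x y → fromℚᵘ (x ℚᵘ.* y) ≡ fromℚᵘ x * fromℚᵘ y
fromℚᵘ-homo-* x y = toℚᵘ-injective (ℚᵘ.≃-trans (toℚᵘ-fromℚᵘ (x ℚᵘ.* y))
  (ℚᵘ.≃-sym (ℚᵘ.≃-trans (toℚᵘ-homo-* (fromℚᵘ x) (fromℚᵘ y))
    (ℚᵘ.*-cong (toℚᵘ-fromℚᵘ x) (toℚᵘ-fromℚᵘ y)))))

/1-homo-+ : ∀ i j → (i ℤ.+ j) / 1 ≡ i / 1 + j / 1
/1-homo-+ i j = trans
  (cong (_/ 1) (sym (cong₂ ℤ._+_ (ℤ.*-identityʳ i) (ℤ.*-identityʳ j))))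
  (fromℚᵘ-homo-+ (mkℚᵘ i 0) (mkℚᵘ j 0))

sum-const : ∀ m c → sum {m} (λ _ → c) ≡ (+ m / 1) * c
sum-const zero    c = sym (*-zeroˡ c)
sum-const (suc m) c = trans (cong (λ z → c + z) (sum-const m c))
  (trans (factor (+ m / 1) c) (cong (_* c) (sym (/1-homo-+ (+ 1) (+ m)))))
  where
  factor : ∀ k c → c + k * c ≡ (1ℚ + k) * c
  factor = solve-∀ ℚ-ring

sum-single : (u : Fin m → ℚ) (i : Fin m) → (∀ k → k ≢ i → u k ≡ 0ℚ) → sum u ≡ u i
sum-single {suc m} u zero    off = trans
  (cong (λ z → u zero + z) (trans (sum-cong-≗ λ k → off (suc k) λ ()) (0ᴸ (sum-linear {m}))))
  (+-identityʳ (u zero))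
sum-single {suc m} u (suc i) off = trans
  (cong₂ _+_ (off zero λ ()) (sum-single (λ k → u (suc k)) i λ k k≢i → off (suc k) λ { refl → k≢i refl }))
  (+-identityˡ (u (suc i)))

+k/n≡k*1/n : ∀ k n .{{_ : NonZero n}} → + k / n ≡ (+ k / 1) * (+ 1 / n)
+k/n≡k*1/n k (suc n) = trans
  (fromℚᵘ-cong {mkℚᵘ (+ k) n} {mkℚᵘ (+ k) 0 ℚᵘ.* mkℚᵘ (+ 1) n} (ℚᵘ.*≡*
    (cong₂ ℤ._*_ (sym (ℤ.*-identityʳ (+ k))) (cong +_ (ℕ.*-identityˡ (suc n))))))
  (fromℚᵘ-homo-* (mkℚᵘ (+ k) 0) (mkℚᵘ (+ 1) n))

n/n≡1 : ∀ n .{{_ : NonZero n}} → + n / n ≡ 1ℚ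
n/n≡1 (suc n) = fromℚᵘ-cong {mkℚᵘ (+ suc n) n} {mkℚᵘ (+ 1) 0} (ℚᵘ.*≡* (ℤ.*-comm (+ suc n) (+ 1)))

*-≡⇒/-≡ : ∀ k n .{{_ : NonZero n}} q → q * (+ n / 1) ≡ + k / 1 → + k / n ≡ q
*-≡⇒/-≡ k n q q*n≡k = begin
  + k / n                        ≡⟨ +k/n≡k*1/n k n ⟩
  (+ k / 1) * (+ 1 / n)          ≡⟨ cong (_* (+ 1 / n)) q*n≡k ⟨
  q * (+ n / 1) * (+ 1 / n)      ≡⟨ *-assoc q (+ n / 1) (+ 1 / n) ⟩
  q * ((+ n / 1) * (+ 1 / n))    ≡⟨ cong (q *_) (+k/n≡k*1/n n n) ⟨
  q * (+ n / n)                  ≡⟨ cong (q *_) (n/n≡1 n) ⟩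
  q * 1ℚ                         ≡⟨ *-identityʳ q ⟩
  q                              ∎
  where open ≡-Reasoning

/1-homo-* : ∀ m n → + (m ℕ.* n) / 1 ≡ (+ m / 1) * (+ n / 1)
/1-homo-* m n = trans (cong (_/ 1) (ℤ.pos-* m n)) (fromℚᵘ-homo-* (mkℚᵘ (+ m) 0) (mkℚᵘ (+ n) 0))

count-++ : (S : Y → Bool) (g : X → Y) (xs : List X) (ys : List Y) →
  length (filterᵇ S (map g xs ++ ys)) ≡
  length (filterᵇ (λ x → S (g x)) xs) ℕ.+ length (filterᵇ S ys)
count-++ S g []       ys = refl
count-++ S g (x ∷ xs) ys with S (g x)
... | true  = cong suc (count-++ S g xs ys)
... | false = count-++ S g xs ys

-- Stated for any `tabulate t` because the induction on `k` passes to the tail of `t`; `allFin` is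
-- the case of the identity.
count-product : (S : VertexSet m (suc n)) {k : ℕ} (t : Fin k → Fin m) (xs : List (Vertex m n)) →
  + length (filterᵇ S (cartesianProductWith _∷_ (tabulate t) xs)) / 1 ≡
  sum λ i → + length (filterᵇ (λ x → S (t i ∷ x)) xs) / 1
count-product S {zero}  t xs = refl
count-product S {suc k} t xs = trans
  (cong (λ c → + c / 1) (count-++ S (t zero ∷_) xs (cartesianProductWith _∷_ (tabulate (λ i → t (suc i))) xs)))
  (trans (/1-homo-+ (+ first) (+ rest))
    (cong (λ z → + first / 1 + z) (count-product S (λ i → t (suc i)) xs)))
  where
  first rest : ℕ
  first = length (filterᵇ (λ x → S (t zero ∷ x)) xs)
  rest  = length (filterᵇ S (cartesianProductWith _∷_ (tabulate (λ i → t (suc i))) xs))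

-- Bilinear forms, means and Boolean indicators.

record IsBilinear (Φ : (X → ℚ) → (X → ℚ) → ℚ) : Set where
  field
    linearˡ : ∀ g → IsLinear (λ f → Φ f g)
    linearʳ : ∀ f → IsLinear (Φ f)

open IsBilinear

record IsMean (M : (X → ℚ) → ℚ) : Set where
  field
    linear : IsLinear M
    constᴹ : ∀ c → M (λ _ → c) ≡ c
    monoᴹ  : ∀ {f g} → (∀ x → f x ≤ g x) → M f ≤ M g

  0≤ᴹ : ∀ {f} → (∀ x → 0ℚ ≤ f x) → 0ℚ ≤ M f
  0≤ᴹ {f} 0≤f = subst (_≤ M f) (constᴹ 0ℚ) (monoᴹ 0≤f)

open IsMean

ind : Bool → ℚ
ind b = if b then 1ℚ else 0ℚ

ind² : ∀ b → ind b * ind b ≡ ind b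
ind² true  = refl
ind² false = refl

0≤ind : ∀ b → 0ℚ ≤ ind b
0≤ind true  = ≤ᵇ⇒≤ tt
0≤ind false = ≤ᵇ⇒≤ tt

ind≤1 : ∀ b → ind b ≤ 1ℚ
ind≤1 true  = ≤ᵇ⇒≤ tt
ind≤1 false = ≤ᵇ⇒≤ tt

ind-xor : ∀ b c → ind (b xor c) ≡ ind b - ind c * (ind b + ind b) + ind c
ind-xor true  true  = refl
ind-xor true  false = refl
ind-xor false true  = refl
ind-xor false false = refl

-- p and l stand for 1 / r and 1 / (r − 1).
module TensorPower (r : ℕ) (p l : ℚ) (p*r≡1 : p * (+ r / 1) ≡ 1ℚ) (p*[1+l]≡l : p * (1ℚ + l) ≡ l)
  (0<p : 0ℚ < p) (0<l : 0ℚ < l) (l≤⅒ : l ≤ + 1 / 10) where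

  0≤p : 0ℚ ≤ p
  0≤p = <⇒≤ 0<p

  0≤l : 0ℚ ≤ l
  0≤l = <⇒≤ 0<l

  l≤1 : l ≤ 1ℚ
  l≤1 = ≤-trans l≤⅒ (≤ᵇ⇒≤ tt)

  -- Averages over one coordinate.

  avg : (Fin r → ℚ) → ℚ
  avg u = p * sum u

  avg-isMean : IsMean avg
  avg-isMean = record
    { linear = scale-linear p sum-linear
    ; constᴹ = λ c → trans (cong (p *_) (sum-const r c))
        (trans (sym (*-assoc p _ c)) (trans (cong (_* c) p*r≡1) (*-identityˡ c)))
    ; monoᴹ  = λ u≤v → *-monoˡ-≤-nonNeg p {{nonNegative 0≤p}} (sum-mono-≤ u≤v)
    }

  avg-linear : IsLinear avg
  avg-linear = linear avg-isMean

  avgᴸ : ∀ {L : (X → ℚ) → ℚ} → IsLinear L → (F : Fin r → X → ℚ) →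
    L (λ x → avg λ i → F i x) ≡ avg λ i → L (F i)
  avgᴸ lin F = trans (*ᴸ lin p _) (cong (p *_) (sumᴸ lin F))

  -- The variance identity for a bilinear form: the cross terms vanish because deviations from the
  -- average have average zero.
  avg-split : ∀ {Φ : (X → ℚ) → (X → ℚ) → ℚ} → IsBilinear Φ → (F G : Fin r → X → ℚ) →
    let F̄ = λ x → avg λ i → F i x
        Ḡ = λ x → avg λ i → G i x
    in avg (λ i → Φ (F i) (G i)) ≡
       Φ F̄ Ḡ + avg (λ i → Φ (λ x → F i x - F̄ x) (λ x → G i x - Ḡ x))
  avg-split {X} {Φ} bil F G = sym (begin
    Φ F̄ Ḡ + avg (λ i → Φ (λ x → F i x - F̄ x) (λ x → G i x - Ḡ x))
      ≡⟨ cong (λ z → Φ F̄ Ḡ + z) (congᴸ avg-linear λ i →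
           trans (-ᴸ (linearˡ bil (λ x → G i x - Ḡ x)) (F i) F̄)
             (cong₂ _-_ (-ᴸ (linearʳ bil (F i)) (G i) Ḡ) (-ᴸ (linearʳ bil F̄) (G i) Ḡ))) ⟩
    Φ F̄ Ḡ + avg (λ i → (u i - v i) - (w i - Φ F̄ Ḡ))
      ≡⟨ cong (λ z → Φ F̄ Ḡ + z) (trans (-ᴸ avg-linear (λ i → u i - v i) (λ i → w i - Φ F̄ Ḡ))
           (cong₂ _-_ (-ᴸ avg-linear u v) (-ᴸ avg-linear w (λ _ → Φ F̄ Ḡ)))) ⟩
    Φ F̄ Ḡ + ((avg u - avg v) - (avg w - avg (λ _ → Φ F̄ Ḡ)))
      ≡⟨ cong (λ z → Φ F̄ Ḡ + z) (cong₂ _-_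
           (cong (λ z → avg u - z) (sym (avgᴸ (linearˡ bil Ḡ) F)))
           (cong₂ _-_ (sym (avgᴸ (linearʳ bil F̄) G)) (constᴹ avg-isMean (Φ F̄ Ḡ)))) ⟩
    Φ F̄ Ḡ + ((avg u - Φ F̄ Ḡ) - (Φ F̄ Ḡ - Φ F̄ Ḡ))
      ≡⟨ collect (Φ F̄ Ḡ) (avg u) ⟩
    avg u ∎)
    where
    open ≡-Reasoning
    F̄ Ḡ : X → ℚ
    F̄ x = avg λ i → F i x
    Ḡ x = avg λ i → G i x
    u v w : Fin r → ℚ
    u i = Φ (F i) (G i)
    v i = Φ (F i) Ḡ
    w i = Φ F̄ (G i)
    collect : ∀ a b → a + ((b - a) - (a - a)) ≡ b
    collect = solve-∀ ℚ-ring

  avg-double-≤ : ∀ s t u v → (∀ i → s * (t i + t i) ≤ u i + v i) →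
    s * (avg t + avg t) ≤ avg u + avg v
  avg-double-≤ s t u v t≤u+v = subst₂ _≤_ (doubleᴸ avg-linear s t) (+ᴸ avg-linear u v)
    (monoᴹ avg-isMean t≤u+v)

  -- Functions on the vertex set and their expectation.

  Fun : ℕ → Set
  Fun n = Vertex r n → ℚ

  slice : Fin r → Fun (suc n) → Fun n
  slice i f x = f (i ∷ x)

  -- Conditional expectation given all coordinates but the first; `deviation` is the complementary
  -- projection, sliced by the first coordinate.
  collapse : Fun (suc n) → Fun n
  collapse f x = avg λ i → f (i ∷ x)

  deviation : Fin r → Fun (suc n) → Fun n
  deviation i f x = f (i ∷ x) - collapse f x

  -- An iterated average rather than a sum over `vertices`, so that every argument can peel off one
  -- coordinate; `E-card` reconciles it with counting.
  E : Fun n → ℚ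
  E {zero}  f = f []
  E {suc n} f = avg λ i → E (slice i f)

  E-isMean : IsMean (E {n})
  E-isMean {zero}  = record
    { linear = eval-linear [] ; constᴹ = λ _ → refl ; monoᴹ = λ f≤g → f≤g [] }
  E-isMean {suc n} = record
    { linear = ∘-linear avg-linear λ i → ∘-linear (linear E-isMean) λ x → eval-linear (i ∷ x)
    ; constᴹ = λ c → trans (congᴸ avg-linear λ _ → constᴹ (E-isMean {n}) c) (constᴹ avg-isMean c)
    ; monoᴹ  = λ f≤g → monoᴹ avg-isMean λ i → monoᴹ (E-isMean {n}) λ x → f≤g (i ∷ x)
    }

  E-linear : IsLinear (E {n})
  E-linear = linear E-isMean

  E-collapse : (f : Fun (suc n)) → E (collapse f) ≡ E f
  E-collapse f = avgᴸ E-linear (λ i → slice i f)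

  -- Inner product and the form of the adjacency operator.

  ⟨_,_⟩ : Fun n → Fun n → ℚ
  ⟨ f , g ⟩ = E λ x → f x * g x

  ⟨,⟩-bilinear : IsBilinear (⟨_,_⟩ {n})
  ⟨,⟩-bilinear = record
    { linearˡ = λ g → ∘-linear E-linear λ x → scaleʳ-linear (g x) (eval-linear x)
    ; linearʳ = λ f → ∘-linear E-linear λ x → scale-linear (f x) (eval-linear x)
    }

  0≤⟨,⟩ : (f : Fun n) → 0ℚ ≤ ⟨ f , f ⟩
  0≤⟨,⟩ f = 0≤ᴹ E-isMean λ x → 0≤² (f x)

  -- ⟨ f , T g ⟩ for the normalised adjacency operator T of K_r^n: on one coordinate
  -- T is (1 + l) times averaging minus l times the identity.
  B : Fun n → Fun n → ℚ
  B {zero}  f g = f [] * g []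
  B {suc n} f g = (1ℚ + l) * B (collapse f) (collapse g) - l * avg λ i → B (slice i f) (slice i g)

  B-bilinear : IsBilinear (B {n})
  B-bilinear {zero} = record
    { linearˡ = λ g → scaleʳ-linear (g []) (eval-linear [])
    ; linearʳ = λ f → scale-linear (f []) (eval-linear [])
    }
  B-bilinear {suc n} = record
    { linearˡ = λ g → sub-linear
        (scale-linear (1ℚ + l) (∘-linear (linearˡ B-bilinear (collapse g)) collapse-linear))
        (scale-linear l (∘-linear avg-linear λ i → ∘-linear (linearˡ B-bilinear (slice i g)) λ x → eval-linear (i ∷ x)))
    ; linearʳ = λ f → sub-linear
        (scale-linear (1ℚ + l) (∘-linear (linearʳ B-bilinear (collapse f)) collapse-linear))
        (scale-linear l (∘-linear avg-linear λ i → ∘-linear (linearʳ B-bilinear (slice i f)) λ x → eval-linear (i ∷ x)))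
    }
    where
    collapse-linear : ∀ x → IsLinear (λ f → collapse {n} f x)
    collapse-linear x = ∘-linear avg-linear λ i → eval-linear (i ∷ x)

  -- On the first coordinate the operator is 1 on constants and -l on mean-zero functions, and these
  -- two parts do not interact.
  B-split : (f g : Fun (suc n)) → B f g ≡
    B (collapse f) (collapse g) - l * avg λ i → B (deviation i f) (deviation i g)
  B-split f g = trans
    (cong (λ z → (1ℚ + l) * B (collapse f) (collapse g) - l * z)
      (avg-split B-bilinear (λ i → slice i f) (λ i → slice i g)))
    (collect l _ _)
    where
    collect : ∀ l a b → (1ℚ + l) * a - l * (a + b) ≡ a - l * b
    collect = solve-∀ ℚ-ring

  ⟨,⟩-split : (f : Fun (suc n)) → ⟨ f , f ⟩ ≡
    ⟨ collapse f , collapse f ⟩ + avg λ i → ⟨ deviation i f , deviation i f ⟩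
  ⟨,⟩-split f = avg-split ⟨,⟩-bilinear (λ i → slice i f) (λ i → slice i f)

  -- All eigenvalues of T lie in [-1, 1]. The sign `s` is a parameter because the factor -l on
  -- deviations calls the induction hypothesis at `- s`.
  B-contraction : ∀ s → s * s ≡ 1ℚ → (f g : Fun n) →
    s * (B f g + B f g) ≤ ⟨ f , f ⟩ + ⟨ g , g ⟩
  B-contraction {zero} s s²≡1 f g = certify (identity s (f []) (g []))
    (0≤+ (0≤² (f [] - s * g [])) (0≤* (≤⇒0≤- (≤-reflexive s²≡1)) (0≤² (g []))))
    where
    identity : ∀ s a b → a * a + b * b - s * (a * b + a * b) ≡
      (a - s * b) * (a - s * b) + (1ℚ - s * s) * (b * b)
    identity = solve-∀ ℚ-ring
  B-contraction {suc n} s s²≡1 f g =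
    step (B (collapse f) (collapse g)) (avg t) ⟨ collapse f , collapse f ⟩ (avg u)
      ⟨ collapse g , collapse g ⟩ (avg v)
      (B-split f g) (⟨,⟩-split f) (⟨,⟩-split g)
      (B-contraction s s²≡1 (collapse f) (collapse g))
      (avg-double-≤ (- s) t u v λ i →
        B-contraction (- s) (trans (neg² s) s²≡1) (deviation i f) (deviation i g))
      (0≤ᴹ avg-isMean λ i → 0≤⟨,⟩ (deviation i f))
      (0≤ᴹ avg-isMean λ i → 0≤⟨,⟩ (deviation i g))
    where
    t u v : Fin r → ℚ
    t i = B (deviation i f) (deviation i g)
    u i = ⟨ deviation i f , deviation i f ⟩
    v i = ⟨ deviation i g , deviation i g ⟩
    -- Forms and norms become variables here, so the splits are substituted by `refl` and the solver
    -- sees only atoms.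
    step : ∀ {x y z} β D ū du v̄ dv → x ≡ β - l * D → y ≡ ū + du → z ≡ v̄ + dv →
      s * (β + β) ≤ ū + v̄ → (- s) * (D + D) ≤ du + dv → 0ℚ ≤ du → 0ℚ ≤ dv →
      s * (x + x) ≤ y + z
    step β D ū du v̄ dv refl refl refl h₁ h₂ 0≤du 0≤dv =
      -- The induction hypothesis for deviations enters with weight `l`; the remaining
      -- `(1ℚ - l) * (du + dv)` is nonnegative.
      certify (identity s l β D ū du v̄ dv)
        (0≤+ (0≤+ (≤⇒0≤- h₁) (0≤* 0≤l (≤⇒0≤- h₂))) (0≤* (≤⇒0≤- l≤1) (0≤+ 0≤du 0≤dv)))
      where
      identity : ∀ s l β D ū du v̄ dv →
        ū + du + (v̄ + dv) - s * (β - l * D + (β - l * D)) ≡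
        (ū + v̄ - s * (β + β)) + l * (du + dv - (- s) * (D + D)) + (1ℚ - l) * (du + dv)
      identity = solve-∀ ℚ-ring

  -- Spectral gap.

  Var : Fun n → ℚ
  Var f = ⟨ f , f ⟩ - E f * E f

  -- With s = 1 and s = −1 this bounds every nontrivial eigenvalue of T by l in absolute value.
  hoffman : ∀ s → s * s ≡ 1ℚ → (f g : Fun n) →
    s * (E f * E g + E f * E g) ≤ s * (B f g + B f g) + l * (Var f + Var g)
  hoffman {zero} s s²≡1 f g = ≤-reflexive (identity s l (f []) (g []))
    where
    identity : ∀ s l a b → s * (a * b + a * b) ≡
      s * (a * b + a * b) + l * ((a * a - a * a) + (b * b - b * b))
    identity = solve-∀ ℚ-ring
  hoffman {suc n} s s²≡1 f g =
    step (B (collapse f) (collapse g)) (avg t) ⟨ collapse f , collapse f ⟩ (avg u)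
      ⟨ collapse g , collapse g ⟩ (avg v)
      (B-split f g) (⟨,⟩-split f) (⟨,⟩-split g) (E-collapse f) (E-collapse g)
      (hoffman s s²≡1 (collapse f) (collapse g))
      (avg-double-≤ s t u v λ i → B-contraction s s²≡1 (deviation i f) (deviation i g))
    where
    t u v : Fin r → ℚ
    t i = B (deviation i f) (deviation i g)
    u i = ⟨ deviation i f , deviation i f ⟩
    v i = ⟨ deviation i g , deviation i g ⟩
    step : ∀ {x y z e ē k k̄} β D ū du v̄ dv → x ≡ β - l * D → y ≡ ū + du → z ≡ v̄ + dv →
      ē ≡ e → k̄ ≡ k →
      s * (ē * k̄ + ē * k̄) ≤ s * (β + β) + l * ((ū - ē * ē) + (v̄ - k̄ * k̄)) →
      s * (D + D) ≤ du + dv →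
      s * (e * k + e * k) ≤ s * (x + x) + l * ((y - e * e) + (z - k * k))
    step {e = e} {k = k} β D ū du v̄ dv refl refl refl refl refl h₁ h₂ =
      certify (identity s l e k β D ū du v̄ dv) (0≤+ (≤⇒0≤- h₁) (0≤* 0≤l (≤⇒0≤- h₂)))
      where
      identity : ∀ s l e k β D ū du v̄ dv →
        s * (β - l * D + (β - l * D)) + l * ((ū + du - e * e) + (v̄ + dv - k * k))
          - s * (e * k + e * k) ≡
        (s * (β + β) + l * ((ū - e * e) + (v̄ - k * k)) - s * (e * k + e * k))
          + l * (du + dv - s * (D + D))
      identity = solve-∀ ℚ-ring

  -- Half of `hoffman` at s = -1 and g = f: off the constants, T is at most l.
  B-upper : (f : Fun n) → B f f ≤ l * ⟨ f , f ⟩ + (1ℚ - l) * (E f * E f)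
  B-upper f = certify (identity l (B f f) ⟨ f , f ⟩ (E f))
    (0≤* {½} (nonNegative⁻¹ ½) (≤⇒0≤- (hoffman (- 1ℚ) refl f f)))
    where
    identity : ∀ l b v e → l * v + (1ℚ - l) * (e * e) - b ≡
      ½ * ((- 1ℚ) * (b + b) + l * ((v - e * e) + (v - e * e)) - (- 1ℚ) * (e * e + e * e))
    identity = solve-∀ ℚ-ring

  -- Degree-one part

  -- The degree-one coefficient of the first coordinate. Later coordinates are read off successive
  -- collapses, since averaging out one coordinate preserves the mean and the other marginals.
  excess : Fun (suc n) → Fin r → ℚ
  excess f i = E (slice i f) - E f

  W : Fun n → ℚ
  W {zero}  f = 0ℚ
  W {suc n} f = avg (λ i → excess f i * excess f i) + W (collapse f)

  E-deviation : ∀ i (f : Fun (suc n)) → E (deviation i f) ≡ excess f i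
  E-deviation i f = trans (-ᴸ E-linear (slice i f) (collapse f))
    (cong (λ z → E (slice i f) - z) (E-collapse f))

  -- T acts as −l on the degree-one part and has all eigenvalues ≥ −l² on the
  -- part of degree at least two.
  level-inequality : (f : Fun n) →
    (1ℚ + l * l) * (E f * E f) ≤ B f f + l * l * ⟨ f , f ⟩ + (l - l * l) * W f
  level-inequality {zero} f = ≤-reflexive (identity l (f []))
    where
    identity : ∀ l a → (1ℚ + l * l) * (a * a) ≡ a * a + l * l * (a * a) + (l - l * l) * 0ℚ
    identity = solve-∀ ℚ-ring
  level-inequality {suc n} f =
    step (B (collapse f) (collapse f)) (avg t) ⟨ collapse f , collapse f ⟩ (avg u) (avg v) (W (collapse f))
      (B-split f f) (⟨,⟩-split f) (E-collapse f) (level-inequality (collapse f))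
      -- The mean of each deviation is the degree-one contribution of this coordinate; on the rest
      -- of the deviation the form is at most `l` times the squared norm.
      (subst (avg t ≤_)
        (trans (axpyᴸ avg-linear (λ i → l * u i) (1ℚ - l) v)
          (cong (_+ (1ℚ - l) * avg v) (*ᴸ avg-linear l u)))
        (monoᴹ avg-isMean λ i → subst (λ z → t i ≤ l * u i + (1ℚ - l) * (z * z)) (E-deviation i f)
          (B-upper (deviation i f))))
    where
    t u v : Fin r → ℚ
    t i = B (deviation i f) (deviation i f)
    u i = ⟨ deviation i f , deviation i f ⟩
    v i = excess f i * excess f i
    step : ∀ {x y e ē} β D ū du G w → x ≡ β - l * D → y ≡ ū + du → ē ≡ e →
      (1ℚ + l * l) * (ē * ē) ≤ β + l * l * ū + (l - l * l) * w →
      D ≤ l * du + (1ℚ - l) * G →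
      (1ℚ + l * l) * (e * e) ≤ x + l * l * y + (l - l * l) * (G + w)
    step {e = e} β D ū du G w refl refl refl h₁ h₂ =
      certify (identity l e β D ū du G w) (0≤+ (≤⇒0≤- h₁) (0≤* 0≤l (≤⇒0≤- h₂)))
      where
      identity : ∀ l e β D ū du G w →
        β - l * D + l * l * (ū + du) + (l - l * l) * (G + w) - (1ℚ + l * l) * (e * e) ≡
        (β + l * l * ū + (l - l * l) * w - (1ℚ + l * l) * (e * e))
          + l * (l * du + (1ℚ - l) * G - D)
      identity = solve-∀ ℚ-ring

  h : Fun n → Fun n
  h {zero}  f x       = 0ℚ
  h {suc n} f (i ∷ x) = excess f i + h (collapse f) x

  avg-excess : (f : Fun (suc n)) → avg (excess f) ≡ 0ℚ
  avg-excess f = trans (-ᴸ avg-linear (λ i → E (slice i f)) (λ _ → E f))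
    (trans (cong (λ z → E f - z) (constᴹ avg-isMean (E f))) (+-inverseʳ (E f)))

  E-h : (f : Fun n) → E (h f) ≡ 0ℚ
  E-h {zero}  f = refl
  E-h {suc n} f = trans (congᴸ avg-linear λ i →
      trans (+ᴸ E-linear (λ _ → excess f i) (h (collapse f)))
        (trans (cong₂ _+_ (constᴹ (E-isMean {n}) (excess f i)) (E-h (collapse f))) (+-identityʳ (excess f i))))
    (avg-excess f)

  -- `h f` is the orthogonal projection of `f` to degree one, so this inner product is its squared
  -- norm. The term with factor `E f` dies because the excesses average to zero.
  ⟨,h⟩ : (f : Fun n) → ⟨ f , h f ⟩ ≡ W f
  ⟨,h⟩ {zero}  f = *-zeroʳ (f [])
  ⟨,h⟩ {suc n} f = begin
    avg (λ i → ⟨ slice i f , slice i (h f) ⟩)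
      ≡⟨ congᴸ avg-linear (λ i → trans (+ᴸ (linearʳ ⟨,⟩-bilinear (slice i f)) (λ _ → g i) k)
           (cong (_+ ⟨ slice i f , k ⟩) (inner i))) ⟩
    avg (λ i → (g i * g i + E f * g i) + ⟨ slice i f , k ⟩)
      ≡⟨ +ᴸ avg-linear (λ i → g i * g i + E f * g i) (λ i → ⟨ slice i f , k ⟩) ⟩
    avg (λ i → g i * g i + E f * g i) + avg (λ i → ⟨ slice i f , k ⟩)
      ≡⟨ cong₂ _+_ (axpyᴸ avg-linear (λ i → g i * g i) (E f) g)
           (sym (avgᴸ (linearˡ ⟨,⟩-bilinear k) (λ i → slice i f))) ⟩
    avg (λ i → g i * g i) + E f * avg g + ⟨ collapse f , k ⟩
      ≡⟨ cong₂ (λ y z → avg (λ i → g i * g i) + E f * y + z) (avg-excess f) (⟨,h⟩ (collapse f)) ⟩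
    avg (λ i → g i * g i) + E f * 0ℚ + W (collapse f)
      ≡⟨ drop (avg (λ i → g i * g i)) (E f) (W (collapse f)) ⟩
    avg (λ i → g i * g i) + W (collapse f) ∎
    where
    open ≡-Reasoning
    g = excess f
    k = h (collapse f)
    drop : ∀ a b c → a + b * 0ℚ + c ≡ a + c
    drop = solve-∀ ℚ-ring
    expand : ∀ a e → (a - e) * a ≡ (a - e) * (a - e) + e * (a - e)
    expand = solve-∀ ℚ-ring
    inner : ∀ i → E (λ x → f (i ∷ x) * g i) ≡ g i * g i + E f * g i
    inner i = trans (congᴸ E-linear λ x → *-comm (f (i ∷ x)) (g i))
      (trans (*ᴸ E-linear (g i) (slice i f)) (expand (E (slice i f)) (E f)))

  -- Variances of independent centred summands add: the cross term carries the mean of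
  -- `h (collapse f)`, which is zero.
  ⟨h,h⟩ : (f : Fun n) → ⟨ h f , h f ⟩ ≡ W f
  ⟨h,h⟩ {zero}  f = refl
  ⟨h,h⟩ {suc n} f = begin
    avg (λ i → E λ x → (g i + k x) * (g i + k x))
      ≡⟨ congᴸ avg-linear (λ i → trans (congᴸ E-linear λ x → expand (g i) (k x)) (inner i)) ⟩
    avg (λ i → g i * g i + W (collapse f))
      ≡⟨ +ᴸ avg-linear (λ i → g i * g i) (λ _ → W (collapse f)) ⟩
    avg (λ i → g i * g i) + avg (λ _ → W (collapse f))
      ≡⟨ cong (λ z → avg (λ i → g i * g i) + z) (constᴹ avg-isMean (W (collapse f))) ⟩
    avg (λ i → g i * g i) + W (collapse f) ∎
    where
    open ≡-Reasoning
    g = excess f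
    k = h (collapse f)
    expand : ∀ c k → (c + k) * (c + k) ≡ k * k + (c + c) * k + c * c
    expand = solve-∀ ℚ-ring
    drop : ∀ a b c → a + b * 0ℚ + c ≡ c + a
    drop = solve-∀ ℚ-ring
    inner : ∀ i → E (λ x → k x * k x + (g i + g i) * k x + g i * g i) ≡ g i * g i + W (collapse f)
    inner i = trans (+ᴸ E-linear (λ x → k x * k x + (g i + g i) * k x) (λ _ → g i * g i))
      (trans (cong₂ _+_ (axpyᴸ E-linear (λ x → k x * k x) (g i + g i) k) (constᴹ (E-isMean {n}) (g i * g i)))
      (trans (cong₂ (λ y z → y + (g i + g i) * z + g i * g i) (⟨h,h⟩ (collapse f)) (E-h (collapse f)))
        (drop (W (collapse f)) (g i + g i) (g i * g i))))

  -- Fourth moment of the degree-one part.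

  Flat : ℚ → Fun n → Set
  Flat {zero}  τ f = ⊤
  Flat {suc n} τ f = (∀ i → excess f i * excess f i ≤ τ) × Flat τ (collapse f)

  -- In the expansion of (g + k)⁴, with g and k independent and centred, the terms g k³ and g³ k
  -- have mean zero. Flatness gives E g⁴ ≤ τ E g², and 3 (E g² + E k²)² absorbs the mixed term 6 E
  -- g² E k².
  E-h⁴ : ∀ τ (f : Fun n) → Flat τ f →
    E (λ x → (h f x * h f x) * (h f x * h f x)) ≤ (+ 3 / 1) * (W f * W f) + τ * W f
  E-h⁴ {zero}  τ f _ = ≤-reflexive (identity τ)
    where
    identity : ∀ τ → 0ℚ ≡ (+ 3 / 1) * (0ℚ * 0ℚ) + τ * 0ℚ
    identity = solve-∀ ℚ-ring
  E-h⁴ {suc n} τ f (flat , flat′) = certify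
    (trans (cong (λ z → (+ 3 / 1) * (W f * W f) + τ * W f - z) moments)
      (identity τ (avg g²) (W (collapse f)) (E k⁴) (avg g⁴)))
    (0≤+ (0≤+ (≤⇒0≤- (E-h⁴ τ (collapse f) flat′)) (≤⇒0≤- avg-g⁴))
      (0≤* {+ 3 / 1} (≤ᵇ⇒≤ tt) (0≤² (avg g²))))
    where
    open ≡-Reasoning
    g g² g⁴ : Fin r → ℚ
    g = excess f
    g² i = g i * g i
    g⁴ i = g² i * g² i
    k k² k³ k⁴ : Fun n
    k = h (collapse f)
    k² x = k x * k x
    k³ x = k² x * k x
    k⁴ x = k² x * k² x
    identity : ∀ τ G w K Q →
      (+ 3 / 1) * ((G + w) * (G + w)) + τ * (G + w) - (Q + (+ 6 / 1) * w * G + K) ≡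
      ((+ 3 / 1) * (w * w) + τ * w - K) + (τ * G - Q) + (+ 3 / 1) * (G * G)
    identity = solve-∀ ℚ-ring
    avg-g⁴ : avg g⁴ ≤ τ * avg g²
    avg-g⁴ = subst (avg g⁴ ≤_) (*ᴸ avg-linear τ g²)
      (monoᴹ avg-isMean λ i → *-monoʳ-≤-nonNeg (g² i) {{nonNegative (0≤² (g i))}} (flat i))
    -- The constant term is a multiple of `1ℚ` so that `axpyᴸ` can peel off every term alike.
    expand : ∀ c k → ((c + k) * (c + k)) * ((c + k) * (c + k)) ≡
      (k * k) * (k * k) + ((+ 4 / 1) * c) * (k * k * k) + ((+ 6 / 1) * (c * c)) * (k * k)
        + ((+ 4 / 1) * (c * c * c)) * k + ((c * c) * (c * c)) * 1ℚ
    expand = solve-∀ ℚ-ring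
    collect : ∀ c w K₃ K →
      K + ((+ 4 / 1) * c) * K₃ + ((+ 6 / 1) * (c * c)) * w
        + ((+ 4 / 1) * (c * c * c)) * 0ℚ + ((c * c) * (c * c)) * 1ℚ ≡
      (c * c) * (c * c) + ((+ 6 / 1) * w) * (c * c) + ((+ 4 / 1) * K₃) * c + K * 1ℚ
    collect = solve-∀ ℚ-ring
    inner : ∀ i → E (λ x → k⁴ x + ((+ 4 / 1) * g i) * k³ x + ((+ 6 / 1) * g² i) * k² x
        + ((+ 4 / 1) * (g² i * g i)) * k x + g⁴ i * 1ℚ) ≡
      E k⁴ + ((+ 4 / 1) * g i) * E k³ + ((+ 6 / 1) * g² i) * E k²
        + ((+ 4 / 1) * (g² i * g i)) * E k + g⁴ i * E {n} (λ _ → 1ℚ)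
    inner i =
      trans (axpyᴸ E-linear (λ x → k⁴ x + ((+ 4 / 1) * g i) * k³ x + ((+ 6 / 1) * g² i) * k² x
              + ((+ 4 / 1) * (g² i * g i)) * k x) (g⁴ i) (λ _ → 1ℚ)) (cong (_+ g⁴ i * E {n} (λ _ → 1ℚ))
      (trans (axpyᴸ E-linear (λ x → k⁴ x + ((+ 4 / 1) * g i) * k³ x + ((+ 6 / 1) * g² i) * k² x)
              ((+ 4 / 1) * (g² i * g i)) k) (cong (_+ ((+ 4 / 1) * (g² i * g i)) * E k)
      (trans (axpyᴸ E-linear (λ x → k⁴ x + ((+ 4 / 1) * g i) * k³ x) ((+ 6 / 1) * g² i) k²)
             (cong (_+ ((+ 6 / 1) * g² i) * E k²)
      (axpyᴸ E-linear k⁴ ((+ 4 / 1) * g i) k³))))))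
    moments : E (λ x → (h f x * h f x) * (h f x * h f x)) ≡
      avg g⁴ + ((+ 6 / 1) * W (collapse f)) * avg g² + E k⁴
    moments = begin
      avg (λ i → E λ x → ((g i + k x) * (g i + k x)) * ((g i + k x) * (g i + k x)))
        ≡⟨ congᴸ avg-linear (λ i → trans (congᴸ E-linear λ x → expand (g i) (k x)) (inner i)) ⟩
      avg (λ i → E k⁴ + ((+ 4 / 1) * g i) * E k³ + ((+ 6 / 1) * g² i) * E k²
        + ((+ 4 / 1) * (g² i * g i)) * E k + g⁴ i * E {n} (λ _ → 1ℚ))
        ≡⟨ congᴸ avg-linear (λ i → trans
             (cong₂ (λ y z → E k⁴ + ((+ 4 / 1) * g i) * E k³ + ((+ 6 / 1) * g² i) * E k²
               + ((+ 4 / 1) * (g² i * g i)) * y + g⁴ i * z) (E-h (collapse f)) (constᴹ (E-isMean {n}) 1ℚ))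
             (collect (g i) (E k²) (E k³) (E k⁴))) ⟩
      avg (λ i → g⁴ i + ((+ 6 / 1) * E k²) * g² i + ((+ 4 / 1) * E k³) * g i + E k⁴ * 1ℚ)
        ≡⟨ trans (axpyᴸ avg-linear (λ i → g⁴ i + ((+ 6 / 1) * E k²) * g² i + ((+ 4 / 1) * E k³) * g i)
                   (E k⁴) (λ _ → 1ℚ)) (cong (_+ E k⁴ * avg (λ _ → 1ℚ))
           (trans (axpyᴸ avg-linear (λ i → g⁴ i + ((+ 6 / 1) * E k²) * g² i) ((+ 4 / 1) * E k³) g)
                  (cong (_+ ((+ 4 / 1) * E k³) * avg g)
           (axpyᴸ avg-linear g⁴ ((+ 6 / 1) * E k²) g²)))) ⟩
      avg g⁴ + ((+ 6 / 1) * E k²) * avg g² + ((+ 4 / 1) * E k³) * avg g + E k⁴ * avg (λ _ → 1ℚ)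
        ≡⟨ cong₂ (λ y z → avg g⁴ + ((+ 6 / 1) * E k²) * avg g² + ((+ 4 / 1) * E k³) * y + E k⁴ * z)
             (avg-excess f) (constᴹ avg-isMean 1ℚ) ⟩
      avg g⁴ + ((+ 6 / 1) * E k²) * avg g² + ((+ 4 / 1) * E k³) * 0ℚ + E k⁴ * 1ℚ
        ≡⟨ drop (avg g⁴ + ((+ 6 / 1) * E k²) * avg g²) ((+ 4 / 1) * E k³) (E k⁴) ⟩
      avg g⁴ + ((+ 6 / 1) * E k²) * avg g² + E k⁴
        ≡⟨ cong (λ z → avg g⁴ + ((+ 6 / 1) * z) * avg g² + E k⁴) (⟨h,h⟩ (collapse f)) ⟩
      avg g⁴ + ((+ 6 / 1) * W (collapse f)) * avg g² + E k⁴ ∎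
      where
      drop : ∀ a b c → a + b * 0ℚ + c * 1ℚ ≡ a + c
      drop = solve-∀ ℚ-ring

  -- Independence

  avg-single : (u : Fin r → ℚ) (i : Fin r) → (∀ k → k ≢ i → u k ≡ 0ℚ) → avg u ≡ p * u i
  avg-single u i off = cong (p *_) (sum-single u i off)

  -- Slices with different first coordinates contribute zero by induction, so the collapsed term
  -- reduces to the diagonal with weight (1 + l) p. This equals l and cancels the subtracted
  -- diagonal.
  B-vanishes : (f g : Fun n) → (∀ x y → Adjacent x y → f x * g y ≡ 0ℚ) → B f g ≡ 0ℚ
  -- Without coordinates the single vertex is vacuously adjacent to itself.
  B-vanishes {zero}  f g fg≡0 = fg≡0 [] [] λ ()
  B-vanishes {suc n} f g fg≡0 = begin
    (1ℚ + l) * B (collapse f) (collapse g) - l * avg diag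
      ≡⟨ cong (λ z → (1ℚ + l) * z - l * avg diag) off-diagonal ⟩
    (1ℚ + l) * (p * avg diag) - l * avg diag
      ≡⟨ identity p l (avg diag) ⟩
    (p * (1ℚ + l) - l) * avg diag
      ≡⟨ cong (_* avg diag) (trans (cong (_- l) p*[1+l]≡l) (+-inverseʳ l)) ⟩
    0ℚ * avg diag
      ≡⟨ *-zeroˡ (avg diag) ⟩
    0ℚ ∎
    where
    open ≡-Reasoning
    diag : Fin r → ℚ
    diag i = B (slice i f) (slice i g)
    identity : ∀ p l d → (1ℚ + l) * (p * d) - l * d ≡ (p * (1ℚ + l) - l) * d
    identity = solve-∀ ℚ-ring
    extend : ∀ {i k} {x y : Vertex r n} → i ≢ k → Adjacent x y → Adjacent (i ∷ x) (k ∷ y)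
    extend i≢k adj zero    = i≢k
    extend i≢k adj (suc j) = adj j
    off-diagonal : B (collapse f) (collapse g) ≡ p * avg diag
    off-diagonal = begin
      B (collapse f) (collapse g)
        ≡⟨ avgᴸ (linearˡ B-bilinear (collapse g)) (λ i → slice i f) ⟩
      avg (λ i → B (slice i f) (collapse g))
        ≡⟨ congᴸ avg-linear (λ i → trans
             (avgᴸ (linearʳ B-bilinear (slice i f)) (λ k → slice k g))
             (avg-single (λ k → B (slice i f) (slice k g)) i λ k k≢i →
               B-vanishes (slice i f) (slice k g) λ x y adj →
                 fg≡0 (i ∷ x) (k ∷ y) (extend (λ i≡k → k≢i (sym i≡k)) adj))) ⟩
      avg (λ i → p * diag i)
        ≡⟨ *ᴸ avg-linear p diag ⟩
      p * avg diag ∎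

  -- Conditional densities on coordinate slices.

  marginal : Fun (suc n) → Fin (suc n) → Fin r → ℚ
  marginal f j i = E λ x → f (insertAt x j i)

  avg-marginal : (f : Fun (suc n)) (j : Fin (suc n)) → avg (marginal f j) ≡ E f
  avg-marginal         f zero    = refl
  avg-marginal {suc n} f (suc j) = trans
    (avgᴸ avg-linear (λ k i → marginal (slice k f) j i))
    (congᴸ avg-linear λ k → avg-marginal (slice k f) j)

  -- Marginals and mean all lie in [0, ½], so they differ by at most ½. Collapsing keeps the
  -- remaining marginals, which drives the recursion.
  marginals≤½⇒Flat : (f : Fun (suc n)) → (∀ x → 0ℚ ≤ f x) → (∀ j i → marginal f j i ≤ ½) →
    Flat (½ * ½) f
  marginals≤½⇒Flat {n} f 0≤f m≤½ =
    (λ i → bound (0≤ᴹ E-isMean λ x → 0≤f (i ∷ x)) (m≤½ zero i) (0≤ᴹ E-isMean 0≤f) E≤½) , rest n f 0≤f m≤½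
    where
    E≤½ : E f ≤ ½
    E≤½ = subst (E f ≤_) (constᴹ avg-isMean ½) (monoᴹ avg-isMean (m≤½ zero))
    bound : 0ℚ ≤ α → α ≤ ½ → 0ℚ ≤ β → β ≤ ½ → (α - β) * (α - β) ≤ ½ * ½
    bound {a} {b} 0≤a a≤½ 0≤b b≤½ = certify (identity a b)
      (0≤* (0≤+ (≤⇒0≤- a≤½) 0≤b) (0≤+ (≤⇒0≤- b≤½) 0≤a))
      where
      identity : ∀ a b → ½ * ½ - (a - b) * (a - b) ≡ (½ - a + b) * (½ - b + a)
      identity = solve-∀ ℚ-ring
    rest : ∀ n (f : Fun (suc n)) → (∀ x → 0ℚ ≤ f x) → (∀ j i → marginal f j i ≤ ½) →
      Flat (½ * ½) (collapse f)
    rest zero    f 0≤f m≤½ = tt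
    rest (suc n) f 0≤f m≤½ = marginals≤½⇒Flat (collapse f)
      (λ x → 0≤ᴹ avg-isMean λ i → 0≤f (i ∷ x))
      (λ j i → subst (_≤ ½) (sym (avgᴸ E-linear λ k x → f (k ∷ insertAt x j i))) (m≤½ (suc j) i))

  -- Indicator functions of independent sets.

  𝟙 : VertexSet r n → Fun n
  𝟙 S x = ind (S x)

  ⟨𝟙,𝟙⟩ : (S : VertexSet r n) → ⟨ 𝟙 S , 𝟙 S ⟩ ≡ E (𝟙 S)
  ⟨𝟙,𝟙⟩ S = congᴸ E-linear λ x → ind² (S x)

  -- Bessel's inequality for the degree-one projection, from 2 f h ≤ f² + h² and ⟨f, h⟩ = ⟨h, h⟩.
  W-𝟙≤E : (S : VertexSet r n) → W (𝟙 S) ≤ E (𝟙 S)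
  W-𝟙≤E S = step
    (subst₂ _≤_ (+ᴸ E-linear fk fk) (+ᴸ E-linear ff kk) (monoᴹ E-isMean λ x → am-gm (f x) (k x)))
    (⟨,h⟩ f) (⟨𝟙,𝟙⟩ S) (⟨h,h⟩ f)
    where
    f k fk ff kk : Fun _
    f = 𝟙 S
    k = h f
    fk x = f x * k x
    ff x = f x * f x
    kk x = k x * k x
    am-gm : ∀ a b → a * b + a * b ≤ a * a + b * b
    am-gm a b = certify (identity a b) (0≤² (a - b))
      where
      identity : ∀ a b → a * a + b * b - (a * b + a * b) ≡ (a - b) * (a - b)
      identity = solve-∀ ℚ-ring
    step : ∀ {w μ x y z} → x + x ≤ y + z → x ≡ w → y ≡ μ → z ≡ w → w ≤ μ
    step {w} {μ} x+x≤y+z refl refl refl = certify (identity w μ) (≤⇒0≤- x+x≤y+z)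
      where
      identity : ∀ w μ → μ - w ≡ μ + w - (w + w)
      identity = solve-∀ ℚ-ring

  -- Pointwise, 4 y ≤ 3 + y⁴ on S and 0 ≤ y⁴ off S, for y the value of h.
  W-𝟙-fourth : (S : VertexSet r n) → Flat (½ * ½) (𝟙 S) →
    W (𝟙 S) ≤ (+ 3 / 4) * E (𝟙 S)
      + (+ 1 / 4) * ((+ 3 / 1) * (W (𝟙 S) * W (𝟙 S)) + ½ * ½ * W (𝟙 S))
  W-𝟙-fourth S flat = ≤-trans
    (subst₂ _≤_ (⟨,h⟩ f)
      (trans (axpyᴸ E-linear (λ x → (+ 3 / 4) * f x) (+ 1 / 4) k⁴)
        (cong (_+ (+ 1 / 4) * E k⁴) (*ᴸ E-linear (+ 3 / 4) f)))
      (monoᴹ E-isMean λ x → pointwise (f x) (k x) (0≤ind (S x)) (ind≤1 (S x))))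
    (+-monoʳ-≤ ((+ 3 / 4) * E f) (*-monoˡ-≤-nonNeg (+ 1 / 4) (E-h⁴ (½ * ½) f flat)))
    where
    f k k⁴ : Fun _
    f = 𝟙 S
    k = h f
    k⁴ x = (k x * k x) * (k x * k x)
    pointwise : ∀ t y → 0ℚ ≤ t → t ≤ 1ℚ → t * y ≤ (+ 3 / 4) * t + (+ 1 / 4) * ((y * y) * (y * y))
    -- At t = 1 the certificate is y⁴ - 4y + 3 = (y - 1)² ((y + 1)² + 2), at t = 0 it is y⁴; the
    -- claim is affine in t.
    pointwise t y 0≤t t≤1 = certify (identity t y) (0≤* {+ 1 / 4} (≤ᵇ⇒≤ tt) (0≤+
      (0≤* 0≤t (0≤* (0≤² (y - 1ℚ)) (0≤+ {β = + 2 / 1} (0≤² (y + 1ℚ)) (≤ᵇ⇒≤ tt))))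
      (0≤* (≤⇒0≤- t≤1) (0≤² (y * y)))))
      where
      identity : ∀ t y → (+ 3 / 4) * t + (+ 1 / 4) * ((y * y) * (y * y)) - t * y ≡
        (+ 1 / 4) * (t * ((y - 1ℚ) * (y - 1ℚ) * ((y + 1ℚ) * (y + 1ℚ) + (+ 2 / 1)))
          + (1ℚ - t) * ((y * y) * (y * y)))
      identity = solve-∀ ℚ-ring

  p≤l : p ≤ l
  p≤l = certify (trans (cong (_- p) (sym p*[1+l]≡l)) (identity p l)) (0≤* 0≤p 0≤l)
    where
    identity : ∀ p l → p * (1ℚ + l) - p ≡ p * l
    identity = solve-∀ ℚ-ring

  B-cross-independent : (S S′ : VertexSet r n) →
    (∀ x y → T (S x) → T (S′ y) → ¬ Adjacent x y) → B (𝟙 S) (𝟙 S′) ≡ 0ℚ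
  B-cross-independent S S′ cross = B-vanishes (𝟙 S) (𝟙 S′) λ x y adj → product x y (cross x y) adj
    where
    product : ∀ x y → (T (S x) → T (S′ y) → ¬ Adjacent x y) → Adjacent x y → 𝟙 S x * 𝟙 S′ y ≡ 0ℚ
    product x y ¬adj adj with S x | S′ y
    ... | true  | true  = contradiction adj (¬adj tt tt)
    ... | true  | false = refl
    ... | false | true  = refl
    ... | false | false = refl

  -- With B = 0, `level-inequality` needs almost all of the mean μ as degree-one weight, while
  -- flatness caps that weight at 7/8 of μ.
  large⇒¬flat : ∀ ε → 0ℚ ≤ ε → ε ≤ + 1 / 100 → (S : VertexSet r n) → Independent S →
    E (𝟙 S) ≡ p * (1ℚ - ε) → ¬ Flat (½ * ½) (𝟙 S)
  large⇒¬flat ε 0≤ε ε≤ S ind-S μ≡ flat = <-irrefl refl (<-≤-trans 0<product product≤0)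
    where
    μ w Z : ℚ
    μ = E (𝟙 S)
    w = W (𝟙 S)
    -- Inserting w ≤ (7/8) μ in `level` and dividing by μ gives (1 + l²) μ ≤ l (7/8 + l/8).
    -- Multiplied by 1 + l, with (1 + l) μ = l (1 - ε), this says Z ≤ 0.
    Z = (1ℚ + l * l) * (1ℚ - ε) - (+ 7 / 8 + (+ 1 / 8) * l) * (1ℚ + l)

    0≤w : 0ℚ ≤ w
    0≤w = subst (0ℚ ≤_) (⟨h,h⟩ (𝟙 S)) (0≤⟨,⟩ (h (𝟙 S)))

    μ≤⅒ : μ ≤ + 1 / 10
    μ≤⅒ = ≤-trans (certify (trans (cong (λ z → p - z) μ≡) (identity p ε)) (0≤* 0≤p 0≤ε)) (≤-trans p≤l l≤⅒)
      where
      identity : ∀ p ε → p - p * (1ℚ - ε) ≡ p * ε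
      identity = solve-∀ ℚ-ring

    w≤⅞μ : w ≤ (+ 7 / 8) * μ
    -- As w ≤ μ ≤ 1/10, the term 3 w² is at most (3/10) w, so the fourth-moment bound yields 3 μ ≥
    -- (69/20) w, and 69/20 exceeds 24/7. The constant 1/140 is the slack.
    w≤⅞μ = certify (identity w μ) (0≤* {+ 7 / 24} (≤ᵇ⇒≤ tt) (0≤+
      (0≤* {+ 4 / 1} (≤ᵇ⇒≤ tt) (≤⇒0≤- (W-𝟙-fourth S flat)))
      (0≤* (0≤* {+ 3 / 1} (≤ᵇ⇒≤ tt) 0≤w)
        (0≤+ {β = + 1 / 140} (0≤+ (≤⇒0≤- μ≤⅒) (≤⇒0≤- (W-𝟙≤E S))) (≤ᵇ⇒≤ tt)))))
      where
      identity : ∀ w μ → (+ 7 / 8) * μ - w ≡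
        (+ 7 / 24) * ((+ 4 / 1) * ((+ 3 / 4) * μ + (+ 1 / 4) * ((+ 3 / 1) * (w * w) + ½ * ½ * w) - w)
          + (+ 3 / 1) * w * ((+ 1 / 10 - μ) + (μ - w) + (+ 1 / 140)))
      identity = solve-∀ ℚ-ring

    level : (1ℚ + l * l) * (μ * μ) ≤ 0ℚ + l * l * μ + (l - l * l) * w
    level = subst₂ (λ y z → (1ℚ + l * l) * (μ * μ) ≤ y + l * l * z + (l - l * l) * w)
      (B-cross-independent S S ind-S) (⟨𝟙,𝟙⟩ S) (level-inequality (𝟙 S))

    [1+l]μ : (1ℚ + l) * μ ≡ l * (1ℚ - ε)
    [1+l]μ = trans (cong ((1ℚ + l) *_) μ≡) (trans (identity p l (1ℚ - ε)) (cong (_* (1ℚ - ε)) p*[1+l]≡l))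
      where
      identity : ∀ p l e → (1ℚ + l) * (p * e) ≡ p * (1ℚ + l) * e
      identity = solve-∀ ℚ-ring

    product≤0 : μ * l * Z ≤ 0ℚ
    product≤0 = certify
      (trans (identity₁ μ l (1ℚ - ε)) (trans (cong remainder (sym [1+l]μ)) (identity₂ μ l w)))
      (0≤* (0≤+ {1ℚ} (≤ᵇ⇒≤ tt) 0≤l) (0≤+ (≤⇒0≤- level)
        (0≤* (0≤* 0≤l (≤⇒0≤- l≤1)) (≤⇒0≤- w≤⅞μ))))
      where
      remainder : ℚ → ℚ
      remainder t = μ * l * ((+ 7 / 8 + (+ 1 / 8) * l) * (1ℚ + l)) - (1ℚ + l * l) * μ * t
      identity₁ : ∀ μ l e → 0ℚ - μ * l * ((1ℚ + l * l) * e - (+ 7 / 8 + (+ 1 / 8) * l) * (1ℚ + l)) ≡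
        μ * l * ((+ 7 / 8 + (+ 1 / 8) * l) * (1ℚ + l)) - (1ℚ + l * l) * μ * (l * e)
      identity₁ = solve-∀ ℚ-ring
      identity₂ : ∀ μ l w →
        μ * l * ((+ 7 / 8 + (+ 1 / 8) * l) * (1ℚ + l)) - (1ℚ + l * l) * μ * ((1ℚ + l) * μ) ≡
        (1ℚ + l) * ((0ℚ + l * l * μ + (l - l * l) * w - (1ℚ + l * l) * (μ * μ))
          + l * (1ℚ - l) * ((+ 7 / 8) * μ - w))
      identity₂ = solve-∀ ℚ-ring

    0<Z : 0ℚ < Z
    0<Z = <-≤-trans (positive⁻¹ (+ 1 / 100)) (certify (identity l ε) (0≤+ (0≤+ (0≤+
      (0≤* (0≤+ {1ℚ} (≤ᵇ⇒≤ tt) (0≤² l)) (≤⇒0≤- ε≤))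
      (0≤* {+ 173 / 200} (≤ᵇ⇒≤ tt) (0≤² l))) (≤⇒0≤- l≤⅒)) (≤ᵇ⇒≤ {0ℚ} {+ 1 / 200} tt)))
      where
      identity : ∀ l ε →
        (1ℚ + l * l) * (1ℚ - ε) - (+ 7 / 8 + (+ 1 / 8) * l) * (1ℚ + l) - (+ 1 / 100) ≡
        (1ℚ + l * l) * (+ 1 / 100 - ε) + (+ 173 / 200) * (l * l) + (+ 1 / 10 - l) + (+ 1 / 200)
      identity = solve-∀ ℚ-ring

    0<μ : 0ℚ < μ
    0<μ = subst (0ℚ <_) (sym μ≡) (0<* 0<p (<-≤-trans (positive⁻¹ (+ 99 / 100))
      (certify (identity ε) (≤⇒0≤- ε≤))))
      where
      identity : ∀ ε → 1ℚ - ε - (+ 99 / 100) ≡ + 1 / 100 - ε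
      identity = solve-∀ ℚ-ring

    0<product : 0ℚ < μ * l * Z
    0<product = 0<* (0<* 0<μ 0<l) 0<Z

  -- The spectral gap bounds a b + a b² by l² (1 - a), and a ≥ ½ makes b at most 2 a b.
  other-slices-small : (S S′ : VertexSet r n) → B (𝟙 S) (𝟙 S′) ≡ 0ℚ → ½ ≤ E (𝟙 S) →
    E (𝟙 S′) ≤ (l * l + l * l) * (1ℚ - E (𝟙 S))
  other-slices-small {n} S S′ B≡0 ½≤a = certify (identity l a b)
    (0≤+ (0≤+ (0≤+ 0≤Q 0≤Q) (0≤+ 0≤abb 0≤abb)) (0≤* (0≤+ (≤⇒0≤- ½≤a) (≤⇒0≤- ½≤a)) 0≤b))
    where
    a b Q : ℚ
    a = E (𝟙 S)
    b = E (𝟙 S′)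
    Q = l * l * (1ℚ - a) - a * b - a * (b * b)
    identity : ∀ l a b → (l * l + l * l) * (1ℚ - a) - b ≡
      (l * l * (1ℚ - a) - a * b - a * (b * b)) + (l * l * (1ℚ - a) - a * b - a * (b * b))
        + (a * (b * b) + a * (b * b)) + ((a - ½) + (a - ½)) * b
    identity = solve-∀ ℚ-ring
    0<a : 0ℚ < a
    0<a = <-≤-trans (positive⁻¹ ½) ½≤a
    0≤b : 0ℚ ≤ b
    0≤b = 0≤ᴹ E-isMean λ x → 0≤ind (S′ x)
    0≤abb : 0ℚ ≤ a * (b * b)
    0≤abb = 0≤* (<⇒≤ 0<a) (0≤² b)
    scaled : ∀ {Φ : Fun n → Fun n → ℚ} → IsBilinear Φ → ∀ c d f g →
      Φ (λ x → c * f x) (λ x → d * g x) ≡ c * (d * Φ f g)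
    scaled bil c d f g = trans (*ᴸ (linearˡ bil (λ x → d * g x)) c f) (cong (c *_) (*ᴸ (linearʳ bil f) d g))
    -- The weights l and a balance the two variance terms of hoffman.
    0≤Q : 0ℚ ≤ Q
    0≤Q = 0≤-cancel-* (l * a) Q (0<* 0<l 0<a) (step
      (hoffman 1ℚ refl (λ x → l * 𝟙 S x) (λ x → a * 𝟙 S′ x))
      (*ᴸ E-linear l (𝟙 S)) (*ᴸ E-linear a (𝟙 S′))
      (trans (scaled B-bilinear l a (𝟙 S) (𝟙 S′)) (cong (λ z → l * (a * z)) B≡0))
      (trans (scaled ⟨,⟩-bilinear l l (𝟙 S) (𝟙 S)) (cong (λ z → l * (l * z)) (⟨𝟙,𝟙⟩ S)))
      (trans (scaled ⟨,⟩-bilinear a a (𝟙 S′) (𝟙 S′)) (cong (λ z → a * (a * z)) (⟨𝟙,𝟙⟩ S′))))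
      where
      step : ∀ {e k x y z} → 1ℚ * (e * k + e * k) ≤ 1ℚ * (x + x) + l * ((y - e * e) + (z - k * k)) →
        e ≡ l * a → k ≡ a * b → x ≡ l * (a * 0ℚ) → y ≡ l * (l * a) → z ≡ a * (a * b) → 0ℚ ≤ l * a * Q
      step e*k≤ refl refl refl refl refl = subst (0ℚ ≤_) (identity′ l a b) (≤⇒0≤- e*k≤)
        where
        identity′ : ∀ l a b →
          1ℚ * (l * (a * 0ℚ) + l * (a * 0ℚ))
            + l * ((l * (l * a) - l * a * (l * a)) + (a * (a * b) - a * b * (a * b)))
            - 1ℚ * (l * a * (a * b) + l * a * (a * b)) ≡
          l * a * (l * l * (1ℚ - a) - a * b - a * (b * b))
        identity′ = solve-∀ ℚ-ring

  -- Deficit of the dominant slice.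

  point : Fin r → Fin r → ℚ
  point i k = ind ⌊ k Fin.≟ i ⌋

  point-diagonal : ∀ i → point i i ≡ 1ℚ
  point-diagonal i with i Fin.≟ i
  ... | yes _   = refl
  ... | no  i≢i = contradiction refl i≢i

  point-off : ∀ i k → k ≢ i → point i k ≡ 0ℚ
  point-off i k k≢i with k Fin.≟ i
  ... | yes k≡i = contradiction k≡i k≢i
  ... | no  _   = refl

  avg-point-* : ∀ i (u : Fin r → ℚ) → avg (λ k → point i k * u k) ≡ p * u i
  avg-point-* i u = trans
    (avg-single (λ k → point i k * u k) i λ k k≢i →
      trans (cong (_* u k) (point-off i k k≢i)) (*-zeroˡ (u k)))
    (cong (p *_) (trans (cong (_* u i) (point-diagonal i)) (*-identityˡ (u i))))

  -- The slices other than i have total weight 1 - p, and (1 - p) l = p turns their bound 2 l² (1 -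
  -- a) into a contribution of 2 l p (1 - a). Dividing by p leaves the claim.
  dominant-slice : ∀ ε (A : Fin r → VertexSet r n) i →
    (∀ k → k ≢ i → B (𝟙 (A i)) (𝟙 (A k)) ≡ 0ℚ) → ½ ≤ E (𝟙 (A i)) →
    avg (λ k → E (𝟙 (A k))) ≡ p * (1ℚ - ε) → (1ℚ - E (𝟙 (A i))) * (1ℚ - (l + l)) ≤ ε
  dominant-slice ε A i cross ½≤a avg≡ = certify refl
    (0≤-cancel-* p (ε - (1ℚ - a) * (1ℚ - (l + l))) 0<p
      (subst (0ℚ ≤_) total (≤⇒0≤- (monoᴹ avg-isMean slices≤))))
    where
    open ≡-Reasoning
    b : Fin r → ℚ
    b k = E (𝟙 (A k))
    a c : ℚ
    a = b i
    c = (l * l + l * l) * (1ℚ - a)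
    slices≤ : ∀ k → b k ≤ c + point i k * (a - c)
    slices≤ k with k Fin.≟ i
    ... | yes refl = ≤-reflexive (on c a)
      where
      on : ∀ c a → a ≡ c + 1ℚ * (a - c)
      on = solve-∀ ℚ-ring
    ... | no k≢i = subst (b k ≤_) (off c (a - c)) (other-slices-small (A i) (A k) (cross k k≢i) ½≤a)
      where
      off : ∀ c d → c ≡ c + 0ℚ * d
      off = solve-∀ ℚ-ring
    expand : ∀ p l a ε → (l * l + l * l) * (1ℚ - a)
        + p * (a - (l * l + l * l) * (1ℚ - a)) - p * (1ℚ - ε) ≡
      (l + l) * (1ℚ - a) * ((1ℚ - p) * l) + (p * a - p * (1ℚ - ε))
    expand = solve-∀ ℚ-ring
    collect : ∀ p l a ε → (l + l) * (1ℚ - a) * p + (p * a - p * (1ℚ - ε)) ≡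
      p * (ε - (1ℚ - a) * (1ℚ - (l + l)))
    collect = solve-∀ ℚ-ring
    [1-p]l≡p : (1ℚ - p) * l ≡ p
    [1-p]l≡p = begin
      (1ℚ - p) * l            ≡⟨ identity₁ p l ⟩
      l - p * (1ℚ + l) + p    ≡⟨ cong (λ z → l - z + p) p*[1+l]≡l ⟩
      l - l + p               ≡⟨ identity₂ p l ⟩
      p                       ∎
      where
      identity₁ : ∀ p l → (1ℚ - p) * l ≡ l - p * (1ℚ + l) + p
      identity₁ = solve-∀ ℚ-ring
      identity₂ : ∀ p l → l - l + p ≡ p
      identity₂ = solve-∀ ℚ-ring
    total : avg (λ k → c + point i k * (a - c)) - avg b ≡ p * (ε - (1ℚ - a) * (1ℚ - (l + l)))
    total = begin
      avg (λ k → c + point i k * (a - c)) - avg b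
        ≡⟨ cong₂ _-_ (trans (+ᴸ avg-linear (λ _ → c) (λ k → point i k * (a - c)))
             (cong₂ _+_ (constᴹ avg-isMean c) (avg-point-* i (λ _ → a - c)))) avg≡ ⟩
      c + p * (a - c) - p * (1ℚ - ε)
        ≡⟨ expand p l a ε ⟩
      (l + l) * (1ℚ - a) * ((1ℚ - p) * l) + (p * a - p * (1ℚ - ε))
        ≡⟨ cong (λ z → (l + l) * (1ℚ - a) * z + (p * a - p * (1ℚ - ε))) [1-p]l≡p ⟩
      (l + l) * (1ℚ - a) * p + (p * a - p * (1ℚ - ε))
        ≡⟨ collect p l a ε ⟩
      p * (ε - (1ℚ - a) * (1ℚ - (l + l))) ∎

  -- Dictators

  dictator : Fin n → Fin r → VertexSet r n
  dictator j i x = ⌊ lookup x j Fin.≟ i ⌋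

  dictator-independent : (j : Fin n) (i : Fin r) → Independent (dictator j i)
  dictator-independent j i x y x∈I y∈I adj =
    adj j (trans (toWitness x∈I) (sym (toWitness y∈I)))

  𝟙-dictator-insertAt : (j : Fin (suc n)) (i k : Fin r) (x : Vertex r n) →
    𝟙 (dictator j i) (insertAt x j k) ≡ point i k
  𝟙-dictator-insertAt j i k x = cong (λ z → ind ⌊ z Fin.≟ i ⌋) (insertAt-lookup x j k)

  E-dictator : (j : Fin (suc n)) (i : Fin r) → E (𝟙 (dictator j i)) ≡ p
  E-dictator {n} j i = begin
    E (𝟙 (dictator j i))              ≡⟨ avg-marginal (𝟙 (dictator j i)) j ⟨
    avg (marginal (𝟙 (dictator j i)) j)
      ≡⟨ congᴸ avg-linear (λ k → trans (congᴸ E-linear (𝟙-dictator-insertAt j i k))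
           (trans (constᴹ (E-isMean {n}) (point i k)) (sym (*-identityʳ (point i k))))) ⟩
    avg (λ k → point i k * 1ℚ)        ≡⟨ avg-point-* i (λ _ → 1ℚ) ⟩
    p * 1ℚ                            ≡⟨ *-identityʳ p ⟩
    p                                 ∎
    where open ≡-Reasoning

  -- Inclusion-exclusion: the intersection with the dictator is one slice of `J`, of density p times
  -- its marginal.
  E-△-dictator : (J : VertexSet r (suc n)) (j : Fin (suc n)) (i : Fin r) →
    E (𝟙 (J △ dictator j i)) ≡ E (𝟙 J) - p * (marginal (𝟙 J) j i + marginal (𝟙 J) j i) + p
  E-△-dictator {n} J j i = begin
    E (𝟙 (J △ I))                ≡⟨ avg-marginal (𝟙 (J △ I)) j ⟨
    avg (marginal (𝟙 (J △ I)) j) ≡⟨ congᴸ avg-linear slicewise ⟩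
    avg (λ k → u k - point i k * (u k + u k) + point i k)
      ≡⟨ +ᴸ avg-linear (λ k → u k - point i k * (u k + u k)) (point i) ⟩
    avg (λ k → u k - point i k * (u k + u k)) + avg (point i)
      ≡⟨ cong₂ _+_ (-ᴸ avg-linear u (λ k → point i k * (u k + u k)))
           (trans (congᴸ avg-linear λ k → sym (*-identityʳ (point i k)))
             (trans (avg-point-* i (λ _ → 1ℚ)) (*-identityʳ p))) ⟩
    avg u - avg (λ k → point i k * (u k + u k)) + p
      ≡⟨ cong₂ (λ y z → y - z + p) (avg-marginal (𝟙 J) j) (avg-point-* i (λ k → u k + u k)) ⟩
    E (𝟙 J) - p * (u i + u i) + p ∎
    where
    open ≡-Reasoning
    I : VertexSet r (suc n)
    I = dictator j i
    u : Fin r → ℚ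
    u = marginal (𝟙 J) j
    slicewise : ∀ k → marginal (𝟙 (J △ I)) j k ≡ u k - point i k * (u k + u k) + point i k
    slicewise k = begin
      E (λ x → ind (J (insertAt x j k) xor I (insertAt x j k)))
        ≡⟨ congᴸ E-linear (λ x → trans (ind-xor (J (insertAt x j k)) (I (insertAt x j k)))
             (cong (λ z → f x - z * (f x + f x) + z) (𝟙-dictator-insertAt j i k x))) ⟩
      E (λ x → f x - point i k * (f x + f x) + point i k)
        ≡⟨ +ᴸ E-linear (λ x → f x - point i k * (f x + f x)) (λ _ → point i k) ⟩
      E (λ x → f x - point i k * (f x + f x)) + E {n} (λ _ → point i k)
        ≡⟨ cong₂ _+_ (-ᴸ E-linear f (λ x → point i k * (f x + f x))) (constᴹ (E-isMean {n}) (point i k)) ⟩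
      E f - E (λ x → point i k * (f x + f x)) + point i k
        ≡⟨ cong (λ z → E f - z + point i k) (doubleᴸ E-linear (point i k) f) ⟩
      E f - point i k * (E f + E f) + point i k ∎
      where
      f : Fun n
      f x = 𝟙 J (insertAt x j k)

  -- Stability of large independent sets.

  insertAt-adjacent : ∀ (j : Fin (suc n)) {i k} {x y : Vertex r n} → i ≢ k → Adjacent x y →
    Adjacent (insertAt x j i) (insertAt y j k)
  insertAt-adjacent zero i≢k adj zero     = i≢k
  insertAt-adjacent zero i≢k adj (suc j′) = adj j′
  insertAt-adjacent {suc n} (suc j) {x = _ ∷ _} {y = _ ∷ _} i≢k adj zero     = adj zero
  insertAt-adjacent {suc n} (suc j) {x = _ ∷ _} {y = _ ∷ _} i≢k adj (suc j′) =
    insertAt-adjacent j i≢k (λ j″ → adj (suc j″)) j′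

  -- A search over the finitely many slices; its failure would make the indicator flat.
  large-marginal : ∀ ε → 0ℚ ≤ ε → ε ≤ + 1 / 100 → (J : VertexSet r (suc n)) → Independent J →
    E (𝟙 J) ≡ p * (1ℚ - ε) → ∃[ j ] ∃[ i ] ½ ≤ marginal (𝟙 J) j i
  large-marginal ε 0≤ε ε≤ J indJ μ≡
    with Fin.any? (λ j → Fin.any? λ i → ½ ≤? marginal (𝟙 J) j i)
  ... | yes large = large
  ... | no ¬large = contradiction
    (marginals≤½⇒Flat (𝟙 J) (λ x → 0≤ind (J x)) λ j i → <⇒≤ (≰⇒> λ ½≤m → ¬large (j , i , ½≤m)))
    (large⇒¬flat ε 0≤ε ε≤ J indJ μ≡)

  -- The distance is p (2 (1 - a) - ε). Since l ≤ 1/10, the deficit bound gives 1 - a ≤ (5/4) ε,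
  -- whence the factor 5/2 - 1 = 3/2.
  stability : ∀ ε → 0ℚ ≤ ε → ε ≤ + 1 / 100 → (J : VertexSet r (suc n)) → Independent J →
    E (𝟙 J) ≡ p * (1ℚ - ε) →
    ∃[ j ] ∃[ i ] E (𝟙 (J △ dictator j i)) ≤ (+ 3 / 2) * ε * p
  stability {n} ε 0≤ε ε≤ J indJ μ≡ with large-marginal ε 0≤ε ε≤ J indJ μ≡
  ... | j , i , ½≤a = j , i , certify
    (trans (cong (λ z → (+ 3 / 2) * ε * p - z)
        (trans (E-△-dictator J j i) (cong (λ z → z - p * (a + a) + p) μ≡)))
      (identity p l a ε))
    (0≤* 0≤p (0≤* {+ 5 / 2} (≤ᵇ⇒≤ tt) (0≤+ (≤⇒0≤- deficit)
      (0≤* (0≤+ (≤⇒0≤- l≤⅒) (≤⇒0≤- l≤⅒)) (≤⇒0≤- a≤1)))))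
    where
    a : ℚ
    a = marginal (𝟙 J) j i
    A : Fin r → VertexSet r n
    A k x = J (insertAt x j k)
    a≤1 : a ≤ 1ℚ
    a≤1 = subst (a ≤_) (constᴹ (E-isMean {n}) 1ℚ) (monoᴹ (E-isMean {n}) λ x → ind≤1 (A i x))
    deficit : (1ℚ - a) * (1ℚ - (l + l)) ≤ ε
    deficit = dominant-slice ε A i
      (λ k k≢i → B-cross-independent (A i) (A k) λ x y x∈A y∈A adj →
        indJ (insertAt x j i) (insertAt y j k) x∈A y∈A (insertAt-adjacent j (λ i≡k → k≢i (sym i≡k)) adj))
      ½≤a (trans (avg-marginal (𝟙 J) j) μ≡)
    identity : ∀ p l a ε → (+ 3 / 2) * ε * p - (p * (1ℚ - ε) - p * (a + a) + p) ≡
      p * ((+ 5 / 2) * ((ε - (1ℚ - a) * (1ℚ - (l + l))) + ((+ 1 / 10 - l) + (+ 1 / 10 - l)) * (1ℚ - a)))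
    identity = solve-∀ ℚ-ring

  -- Expectation as normalised counting.

  E-card : (S : VertexSet r n) → E (𝟙 S) * (+ (r ℕ.^ n) / 1) ≡ + card S / 1
  E-card {zero} S with S []
  ... | true  = refl
  ... | false = refl
  E-card {suc n} S = begin
    p * sum e * (+ (r ℕ.* r ℕ.^ n) / 1)      ≡⟨ cong (p * sum e *_) (/1-homo-* r (r ℕ.^ n)) ⟩
    p * sum e * (R * N)                      ≡⟨ regroup p (sum e) R N ⟩
    p * R * (sum e * N)                      ≡⟨ cong (_* (sum e * N)) p*r≡1 ⟩
    1ℚ * (sum e * N)                         ≡⟨ *-identityˡ (sum e * N) ⟩
    sum e * N                                ≡⟨ *-distribʳ-sum N e ⟩
    sum (λ i → e i * N)                      ≡⟨ sum-cong-≗ (λ i → E-card (λ x → S (i ∷ x))) ⟩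
    sum (λ i → + card (λ x → S (i ∷ x)) / 1) ≡⟨ count-product S (λ i → i) (vertices r n) ⟨
    + card S / 1                             ∎
    where
    open ≡-Reasoning
    e : Fin r → ℚ
    e i = E (slice i (𝟙 S))
    R N : ℚ
    R = + r / 1
    N = + (r ℕ.^ n) / 1
    regroup : ∀ p s R N → p * s * (R * N) ≡ p * R * (s * N)
    regroup = solve-∀ ℚ-ring

  density≡E : .{{_ : NonZero r}} (S : VertexSet r n) → density S ≡ E (𝟙 S)
  density≡E {n} S = *-≡⇒/-≡ (card S) (r ℕ.^ n) {{ℕ.m^n≢0 r n}} (E (𝟙 S)) (E-card S)

-- At ε = 0 the right-hand side vanishes and no density lies strictly below it; the bound is
-- therefore weak in general and strict for positive ε. The witness is a dictator.
theorem1 : (r n : ℕ) .{{_ : NonZero r}} → r ℕ.≥ 20 → n ℕ.≥ 1 →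
    (ε : ℚ) → 0ℚ ≤ ε → ε < + 1 / (10 ℕ.^ 9) →
    (J : VertexSet r n) → Independent J →
    density J ≡ (+ 1 / r) * (1ℚ - ε) →
    ∃[ I ] (Independent {r} {n} I
    × density I ≡ + 1 / r
    × density (J △ I) ≤ (+ 40 / 1) * ε * (+ 1 / r)
    × (0ℚ < ε → density (J △ I) < (+ 40 / 1) * ε * (+ 1 / r)))
theorem1 (suc r′) (suc n) 20≤r _ ε 0≤ε ε< J indJ dJ =
  I , dictator-independent j i , trans (density≡E I) (E-dictator j i) ,
  ≤-trans small (certify (slack ε p) (0≤* {+ 77 / 2} (≤ᵇ⇒≤ tt) (0≤* 0≤ε (<⇒≤ 0<p)))) ,
  λ 0<ε → ≤-<-trans small (strict 0<ε)
  where
  -- Here r = r′ + 1, so l = 1/(r - 1) is 1/r′, and its bound by 1/10 rests on this.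
  10≤r′ : 10 ℕ.≤ r′
  10≤r′ = ℕ.≤-pred (ℕ.≤-trans (ℕ.m≤m+n 11 9) 20≤r)
  instance
    r′≢0 : NonZero r′
    r′≢0 = ℕ.>-nonZero (ℕ.≤-trans (ℕ.m≤m+n 1 9) 10≤r′)
  p l q : ℚ
  p = + 1 / suc r′
  l = + 1 / r′
  q = + r′ / 1
  inverse : ∀ k .{{_ : NonZero k}} → (+ 1 / k) * (+ k / 1) ≡ 1ℚ
  inverse k = trans (*-comm (+ 1 / k) (+ k / 1)) (trans (sym (+k/n≡k*1/n k k)) (n/n≡1 k))
  0<p : 0ℚ < p
  0<p = positive⁻¹ p {{normalize-pos 1 (suc r′)}}
  0<l : 0ℚ < l
  0<l = positive⁻¹ l {{normalize-pos 1 r′}}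
  p*[1+q]≡1 : p * (1ℚ + q) ≡ 1ℚ
  p*[1+q]≡1 = trans (cong (p *_) (sym (/1-homo-+ (+ 1) (+ r′)))) (inverse (suc r′))
  p*[1+l]≡l : p * (1ℚ + l) ≡ l
  p*[1+l]≡l = begin
    p * (1ℚ + l)       ≡⟨ cong (λ z → p * (z + l)) (inverse r′) ⟨
    p * (l * q + l)    ≡⟨ regroup p l q ⟩
    p * (1ℚ + q) * l   ≡⟨ cong (_* l) p*[1+q]≡1 ⟩
    1ℚ * l             ≡⟨ *-identityˡ l ⟩
    l                  ∎
    where
    open ≡-Reasoning
    regroup : ∀ p l q → p * (l * q + l) ≡ p * (1ℚ + q) * l
    regroup = solve-∀ ℚ-ring
  l≤⅒ : l ≤ + 1 / 10
  -- From l r′ = 1, the difference 1/10 - l equals (1/10) l (r′ - 10).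
  l≤⅒ = certify
    (trans (identity₁ l) (trans (cong (λ z → (+ 1 / 10) * (z - (+ 10 / 1) * l)) (sym l*q≡1)) (identity₂ l k)))
    (0≤* {+ 1 / 10} (≤ᵇ⇒≤ tt) (0≤* (<⇒≤ 0<l) (nonNegative⁻¹ k {{normalize-nonNeg (r′ ℕ.∸ 10) 1}})))
    where
    k : ℚ
    k = + (r′ ℕ.∸ 10) / 1
    l*q≡1 : l * (+ 10 / 1 + k) ≡ 1ℚ
    l*q≡1 = trans (cong (l *_) (trans (sym (/1-homo-+ (+ 10) (+ (r′ ℕ.∸ 10))))
      (cong (λ z → + z / 1) (ℕ.m+[n∸m]≡n 10≤r′)))) (inverse r′)
    identity₁ : ∀ l → + 1 / 10 - l ≡ (+ 1 / 10) * (1ℚ - (+ 10 / 1) * l)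
    identity₁ = solve-∀ ℚ-ring
    identity₂ : ∀ l k → (+ 1 / 10) * (l * (+ 10 / 1 + k) - (+ 10 / 1) * l) ≡ (+ 1 / 10) * (l * k)
    identity₂ = solve-∀ ℚ-ring
  open TensorPower (suc r′) p l (inverse (suc r′)) p*[1+l]≡l 0<p 0<l l≤⅒
    using (dictator; dictator-independent; E-dictator; density≡E; stability)
  close = stability ε 0≤ε (≤-trans (<⇒≤ ε<) (≤ᵇ⇒≤ tt)) J indJ (trans (sym (density≡E J)) dJ)
  j = proj₁ close
  i = proj₁ (proj₂ close)
  I : VertexSet (suc r′) (suc n)
  I = dictator j i
  small : density (J △ I) ≤ (+ 3 / 2) * ε * p
  small = subst (_≤ (+ 3 / 2) * ε * p) (sym (density≡E (J △ I))) (proj₂ (proj₂ close))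
  slack : ∀ ε p → (+ 40 / 1) * ε * p - (+ 3 / 2) * ε * p ≡ (+ 77 / 2) * (ε * p)
  slack = solve-∀ ℚ-ring
  strict : 0ℚ < ε → (+ 3 / 2) * ε * p < (+ 40 / 1) * ε * p
  strict 0<ε = *-monoˡ-<-pos p {{positive 0<p}} (*-monoˡ-<-pos ε {{positive 0<ε}} (toWitness {a? = + 3 / 2 <? + 40 / 1} tt))
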